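{- Let $C_{(\neq,\neq)}(x,y)$ be the bivariate generating function of the Catalan words avoiding the ordered pair of relations $(\neq,\neq)$, where $x$ marks the length and $y$ marks the number of descents. Then $$C_{(\neq,\neq)}(x,y)=\frac{1 - x - x^2 - \sqrt{(1 - x - x^2)^2 - 4 x^4 y}}{2 x^4 y}.$$
   Context: A Catalan word of length $n$ is a word $w=w_1w_2\cdots w_n$ over the non-negative integers with $w_1=0$ and $0\leq w_i\leq w_{i-1}+1$ for $i=2,\dots,n$; the empty word is the unique Catalan word of length $0$. For relations $X,Y\in\{<,>,\leq,\geq,=,\neq\}$, a word $w$ contains the pattern $(X,Y)$ if there is an index $i\geq 1$ (with $i+2\le n$) such that $w_i\,X\,w_{i+1}$ and $w_{i+1}\,Y\,w_{i+2}$; otherwise $w$ avoids $(X,Y)$. The number of descents $\mathrm{des}(w)$ is the number of indices $i$ with $w_i>w_{i+1}$. The bivariate generating function is $C_{(X,Y)}(x,y)=\sum_{w}x^{|w|}y^{\mathrm{des}(w)}$, the sum being over all Catalan words $w$ (of any length $|w|\geq 0$) avoiding $(X,Y)$. Identities are between formal power series in $x$ with coefficients polynomials in $y$ (after clearing denominators); the square root of a power series with constant term $1$ is the one with constant term $1$. -}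

module Defs where

open import Data.Nat.Base as ℕ using (ℕ; zero; suc; _≤_; _<ᵇ_; s≤s; s≤s⁻¹)
import Data.Nat.Properties as ℕₚ
open import Data.Integer.Base as ℤ using (ℤ; +_; 0ℤ; 1ℤ)
open import Data.Bool.Base using (if_then_else_)
open import Data.List.Base
  using (List; []; _∷_; _++_; map; foldr; filter; concatMap; length; replicate; upTo; applyUpTo)
open import Data.List.Properties using (∷-injectiveˡ; ∷-injectiveʳ)
open import Data.List.Membership.Propositional using (_∈_; lose; find)
open import Data.List.Membership.Propositional.Properties
  using (∈-map⁺; ∈-map⁻; ∈-concatMap⁺; ∈-concatMap⁻; ∈-upTo⁺; ∈-upTo⁻)
open import Data.List.Relation.Unary.Any using (here)
open import Data.List.Relation.Unary.All as All using ([])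
import Data.List.Relation.Unary.All.Properties as Allₚ
open import Data.List.Relation.Unary.AllPairs as AllPairs using ([]; _∷_)
import Data.List.Relation.Unary.AllPairs.Properties as AllPairsₚ
open import Data.List.Relation.Unary.Linked using (Linked; []; [-]; _∷_)
open import Data.List.Relation.Unary.Unique.Propositional using (Unique)
import Data.List.Relation.Unary.Unique.Propositional.Properties as Uniqueₚ
open import Data.Product.Base using (_×_; _,_)
open import Data.Unit.Base using (⊤; tt)
open import Function.Bundles using (_⇔_; mk⇔)
open import Level using (0ℓ)
open import Relation.Binary.Core using (Rel)
open import Relation.Binary.Definitions using (Decidable)
open import Relation.Binary.PropositionalEquality using (_≡_; _≢_; refl; cong; sym; trans)
open import Relation.Nullary.Negation using (¬_)
open import Relation.Nullary.Decidable using (yes; no; ¬?; _×-dec_)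
import Relation.Unary as U

------------------------------------------------------------------------
-- Catalan words

Word : Set
Word = List ℕ

Step : Rel ℕ 0ℓ
Step a b = b ≤ suc a

IsCatalan : Word → Set
IsCatalan []      = ⊤
IsCatalan (a ∷ w) = a ≡ 0 × Linked Step (a ∷ w)

des : Word → ℕ
des []          = 0
des (_ ∷ [])    = 0
des (a ∷ b ∷ w) = if b <ᵇ a then suc (des (b ∷ w)) else des (b ∷ w)

data Contains (X Y : Rel ℕ 0ℓ) : Word → Set where
  here  : ∀ {a b c w} → X a b → Y b c → Contains X Y (a ∷ b ∷ c ∷ w)
  there : ∀ {a w} → Contains X Y w → Contains X Y (a ∷ w)

Avoids : (X Y : Rel ℕ 0ℓ) → Word → Set
Avoids X Y w = ¬ Contains X Y w

contains? : ∀ {X Y} → Decidable X → Decidable Y → U.Decidable (Contains X Y)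
contains? X? Y? []           = no λ ()
contains? X? Y? (_ ∷ [])     = no λ { (there ()) }
contains? X? Y? (_ ∷ _ ∷ []) = no λ { (there (there ())) }
contains? X? Y? (a ∷ b ∷ c ∷ w) with X? a b ×-dec Y? b c | contains? X? Y? (b ∷ c ∷ w)
... | yes (p , q) | _     = yes (here p q)
... | no _        | yes r = yes (there r)
... | no ¬pq      | no ¬r = no λ { (here p q) → ¬pq (p , q) ; (there r) → ¬r r }

avoids? : ∀ {X Y} → Decidable X → Decidable Y → U.Decidable (Avoids X Y)
avoids? X? Y? w = ¬? (contains? X? Y? w)

_≢?_ : Decidable {A = ℕ} _≢_
a ≢? b = ¬? (a ℕₚ.≟ b)

-- The words w of length n such that Linked Step (a ∷ w).
continuations : ℕ → ℕ → List Word
continuations a zero    = [] ∷ []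
continuations a (suc n) =
  concatMap (λ b → map (b ∷_) (continuations b n)) (upTo (suc (suc a)))

catalanWords : ℕ → List Word
catalanWords zero    = [] ∷ []
catalanWords (suc n) = map (0 ∷_) (continuations 0 n)

-- catalanWords n lists every Catalan word of length n (∈-catalanWords)
-- exactly once (catalanWords-unique).

private
  ∈-continuations⁺ : ∀ a w → Linked Step (a ∷ w) → w ∈ continuations a (length w)
  ∈-continuations⁺ a []      _       = here refl
  ∈-continuations⁺ a (b ∷ w) (s ∷ l) =
    ∈-concatMap⁺ (λ b → map (b ∷_) (continuations b (length w)))
      (lose (∈-upTo⁺ (s≤s s)) (∈-map⁺ (b ∷_) (∈-continuations⁺ b w l)))

  ∈-continuations⁻ : ∀ a n {w} → w ∈ continuations a n → Linked Step (a ∷ w) × length w ≡ n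
  ∈-continuations⁻ a zero    (here refl) = [-] , refl
  ∈-continuations⁻ a (suc n) w∈
    with find (∈-concatMap⁻ (λ b → map (b ∷_) (continuations b n)) {xs = upTo (suc (suc a))} w∈)
  ... | b , b∈ , w∈′ with ∈-map⁻ (b ∷_) w∈′
  ... | v , v∈ , refl with ∈-continuations⁻ b n v∈
  ... | l , e = s≤s⁻¹ (∈-upTo⁻ b∈) ∷ l , cong suc e

  continuations-unique : ∀ a n → Unique (continuations a n)
  continuations-unique a zero    = [] ∷ []
  continuations-unique a (suc n) =
    Uniqueₚ.concat⁺
      (Allₚ.map⁺ (All.universal
        (λ b → Uniqueₚ.map⁺ ∷-injectiveʳ (continuations-unique b n)) _))
      (AllPairsₚ.map⁺ (AllPairs.map (λ { b≢c {_} (p , q) → disjoint b≢c p q })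
        (Uniqueₚ.upTo⁺ (suc (suc a)))))
    where
    disjoint : ∀ {b c w} → b ≢ c →
               w ∈ map (b ∷_) (continuations b n) → ¬ w ∈ map (c ∷_) (continuations c n)
    disjoint {b} {c} b≢c p q with ∈-map⁻ (b ∷_) p | ∈-map⁻ (c ∷_) q
    ... | _ , _ , e | _ , _ , f = b≢c (∷-injectiveˡ (trans (sym e) f))

∈-catalanWords : ∀ n w → w ∈ catalanWords n ⇔ (IsCatalan w × length w ≡ n)
∈-catalanWords n w = mk⇔ (to n) (from w)
  where
  to : ∀ n {w} → w ∈ catalanWords n → IsCatalan w × length w ≡ n
  to zero    (here refl) = tt , refl
  to (suc n) w∈ with ∈-map⁻ (0 ∷_) w∈
  ... | v , v∈ , refl with ∈-continuations⁻ 0 n v∈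
  ... | l , e = (refl , l) , cong suc e

  from : ∀ w {n} → IsCatalan w × length w ≡ n → w ∈ catalanWords n
  from []      (_ , refl)          = here refl
  from (_ ∷ w) ((refl , l) , refl) = ∈-map⁺ (0 ∷_) (∈-continuations⁺ 0 w l)

catalanWords-unique : ∀ n → Unique (catalanWords n)
catalanWords-unique zero    = [] ∷ []
catalanWords-unique (suc n) = Uniqueₚ.map⁺ ∷-injectiveʳ (continuations-unique 0 n)

------------------------------------------------------------------------
-- Polynomials in y over ℤ, as coefficient lists (constant term first).
-- Trailing zeros are allowed, so equality is _≈ₚ_ rather than _≡_.

Poly : Set
Poly = List ℤ

coeff : Poly → ℕ → ℤ
coeff []      _       = 0ℤ
coeff (a ∷ _) zero    = a
coeff (_ ∷ p) (suc k) = coeff p k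

infix  4 _≈ₚ_
infixl 6 _+ₚ_
infixl 7 _*ₚ_

_≈ₚ_ : Rel Poly 0ℓ
p ≈ₚ q = ∀ k → coeff p k ≡ coeff q k

0ₚ 1ₚ : Poly
0ₚ = []
1ₚ = 1ℤ ∷ []

y^ₚ_ : ℕ → Poly
y^ₚ k = replicate k 0ℤ ++ 1ₚ

_+ₚ_ : Poly → Poly → Poly
[]      +ₚ q       = q
(a ∷ p) +ₚ []      = a ∷ p
(a ∷ p) +ₚ (b ∷ q) = a ℤ.+ b ∷ p +ₚ q

-ₚ_ : Poly → Poly
-ₚ_ = map (ℤ.-_)

_*ₚ_ : Poly → Poly → Poly
[]      *ₚ q = []
(a ∷ p) *ₚ q = map (a ℤ.*_) q +ₚ (0ℤ ∷ p *ₚ q)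

sumₚ : List Poly → Poly
sumₚ = foldr _+ₚ_ 0ₚ

------------------------------------------------------------------------
-- Formal power series in x over ℤ[y]: f n is the coefficient of xⁿ.

Series : Set
Series = ℕ → Poly

infix  4 _≈_
infixl 6 _+_ _-_
infixl 7 _*_
infixr 8 _^_

_≈_ : Rel Series 0ℓ
f ≈ g = ∀ n → f n ≈ₚ g n

const : Poly → Series
const p zero    = p
const p (suc _) = 0ₚ

nat : ℕ → Series
nat m = const (+ m ∷ [])

x y : Series
x 1 = 1ₚ
x _ = 0ₚ
y   = const (y^ₚ 1)

_+_ _-_ _*_ : Series → Series → Series
(f + g) n = f n +ₚ g n
(f - g) n = f n +ₚ (-ₚ g n)
(f * g) n = sumₚ (applyUpTo (λ i → f i *ₚ g (n ℕ.∸ i)) (suc n))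

_^_ : Series → ℕ → Series
f ^ zero  = nat 1
f ^ suc k = f * f ^ k

-- s is the square root of f whose constant term (the coefficient of x⁰) is 1.
IsSqrt : Series → Series → Set
IsSqrt f s = s * s ≈ f × s 0 ≈ₚ 1ₚ

------------------------------------------------------------------------
-- The generating function C_(X,Y)(x,y) of Catalan words avoiding (X,Y).

C : {X Y : Rel ℕ 0ℓ} → Decidable X → Decidable Y → Series
C X? Y? n = sumₚ (map (λ w → y^ₚ des w) (filter (avoids? X? Y?) (catalanWords n)))

-- Call a continuation of a prefix ending in a locked if the last step into a was ≠, so that it
-- is empty or starts with a. Let L a be the generating function of the locked continuations of a.
-- Splitting on the step that follows the forced repetition of a gives
--   L a = 1 + x (L a + x L (a + 1) + x y (L 0 + ... + L (a - 1))),
-- and C = L 0. Both L (a + 1) and L a + x² y (L 0) (L a) solve the system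
--   G a = 1 + x² y (L 0) + x (G a + x G (a + 1) + x y (G 0 + ... + G (a - 1))),
-- whose solution is unique, so L 1 = C + x² y C² and C = 1 + (x + x²) C + x⁴ y C². Completing the
-- square, 1 - x - x² - 2 x⁴ y C is the square root of the discriminant.
module Submission where

open import Algebra.Bundles using (CommutativeRing; RawRing)
import Algebra.Consequences.Setoid as Consequences
import Algebra.Construct.Pointwise as Pointwise
import Algebra.Morphism.RingMonomorphism as RingMonomorphism
open import Algebra.Morphism.Structures using (IsRingMonomorphism)
import Algebra.Properties.CommutativeSemigroup as CommutativeSemigroupProperties
import Algebra.Properties.Group as GroupProperties
import Algebra.Properties.Ring as RingProperties
import Algebra.Solver.Ring.NaturalCoefficients.Default as SemiringSolver
open import Algebra.Structures using (IsCommutativeRing; module IsAbelianGroup)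
open import Data.Bool.Base using (true; false; if_then_else_)
open import Data.Bool.Properties using (T-≡)
open import Data.Integer.Base as ℤ using (ℤ; 0ℤ; 1ℤ; +_)
import Data.Integer.Properties as ℤₚ
open import Data.List.Base
  using (List; []; _∷_; _∷ʳ_; _++_; map; foldr; filter; concatMap; applyUpTo; upTo)
open import Data.List.Properties using (map-∘; upTo-∷ʳ)
open import Data.Nat.Base using (ℕ; zero; suc; _∸_; _≤_; _<_; _<ᵇ_; z≤n; s≤s)
import Data.Nat.Properties as ℕₚ
open import Data.Product.Base using (_,_)
open import Function.Base using (_∘_)
open import Function.Bundles using (_⇔_; mk⇔; Equivalence)
open import Level using (0ℓ)
open import Relation.Binary.Bundles using (Setoid)
open import Relation.Binary.PropositionalEquality as ≡ using (_≡_; _≢_)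
import Relation.Binary.Reasoning.Setoid as SetoidReasoning
open import Relation.Nullary.Decidable using (does; yes; no; does-⇔; dec-true; dec-false)
open import Relation.Unary using (Decidable; Pred)
open import Defs using
  ( Word; des; here; there; Avoids; avoids?; _≢?_; continuations; catalanWords
  ; Poly; coeff; _≈ₚ_; 0ₚ; 1ₚ; y^ₚ_; _+ₚ_; -ₚ_; _*ₚ_ )

-- Finite sums, the linear system and the quadratic over a commutative ring.

module RingIdentities {c ℓ} (R : CommutativeRing c ℓ) where
  open CommutativeRing R
  open SemiringSolver commutativeSemiring
  open SetoidReasoning setoid
  open RingProperties ring using (-‿distribˡ-*)
  open GroupProperties +-group using (∙-cancelʳ)

  below : (ℕ → Carrier) → ℕ → Carrier
  below F zero    = 0#
  below F (suc a) = below F a + F a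

  below-cong : ∀ {F G} a → (∀ b → b < a → F b ≈ G b) → below F a ≈ below G a
  below-cong zero    F≈G = refl
  below-cong (suc a) F≈G =
    +-cong (below-cong a λ b b<a → F≈G b (ℕₚ.m<n⇒m<1+n b<a)) (F≈G a ℕₚ.≤-refl)

  below-zero : ∀ {F} a → (∀ b → b < a → F b ≈ 0#) → below F a ≈ 0#
  below-zero zero    F≈0 = refl
  below-zero (suc a) F≈0 = trans
    (+-cong (below-zero a λ b b<a → F≈0 b (ℕₚ.m<n⇒m<1+n b<a)) (F≈0 a ℕₚ.≤-refl))
    (+-identityˡ 0#)

  below-suc : ∀ F a → below F (suc a) ≈ F 0 + below (F ∘ suc) a
  below-suc F zero    = trans (+-identityˡ _) (sym (+-identityʳ _))
  below-suc F (suc a) = trans (+-congʳ (below-suc F a)) (+-assoc _ _ _)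

  *-distribˡ-below : ∀ r F a → r * below F a ≈ below (λ b → r * F b) a
  *-distribˡ-below r F zero    = zeroʳ r
  *-distribˡ-below r F (suc a) =
    trans (distribˡ r _ _) (+-congʳ (*-distribˡ-below r F a))

  below-+ : ∀ F G a → below (λ b → F b + G b) a ≈ below F a + below G a
  below-+ F G zero    = sym (+-identityˡ _)
  below-+ F G (suc a) = trans (+-congʳ (below-+ F G a)) (interchange _ _ _ _)
    where open CommutativeSemigroupProperties +-commutativeSemigroup using (interchange)

  ∑ : {A : Set} → (A → Carrier) → List A → Carrier
  ∑ F xs = foldr _+_ 0# (map F xs)

  module _ {A : Set} where
    ∑-cong : {F G : A → Carrier} → (∀ x → F x ≈ G x) → ∀ xs → ∑ F xs ≈ ∑ G xs
    ∑-cong F≈G []       = refl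
    ∑-cong F≈G (x ∷ xs) = +-cong (F≈G x) (∑-cong F≈G xs)

    ∑-zero : {F : A → Carrier} → (∀ x → F x ≈ 0#) → ∀ xs → ∑ F xs ≈ 0#
    ∑-zero F≈0 []       = refl
    ∑-zero F≈0 (x ∷ xs) = trans (+-cong (F≈0 x) (∑-zero F≈0 xs)) (+-identityʳ 0#)

    ∑-++ : ∀ (F : A → Carrier) xs ys → ∑ F (xs ++ ys) ≈ ∑ F xs + ∑ F ys
    ∑-++ F []       ys = sym (+-identityˡ _)
    ∑-++ F (x ∷ xs) ys = trans (+-congˡ (∑-++ F xs ys)) (sym (+-assoc _ _ _))

    *-distribˡ-∑ : ∀ r (F : A → Carrier) xs → r * ∑ F xs ≈ ∑ (λ x → r * F x) xs
    *-distribˡ-∑ r F []       = zeroʳ r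
    *-distribˡ-∑ r F (x ∷ xs) = trans (distribˡ r _ _) (+-congˡ (*-distribˡ-∑ r F xs))

    ∑-filter : {Q : Pred A 0ℓ} (Q? : Decidable Q) (F : A → Carrier) → ∀ xs →
               ∑ F (filter Q? xs) ≈ ∑ (λ x → if does (Q? x) then F x else 0#) xs
    ∑-filter Q? F []       = refl
    ∑-filter Q? F (x ∷ xs) with does (Q? x)
    ... | true  = +-congˡ (∑-filter Q? F xs)
    ... | false = trans (∑-filter Q? F xs) (sym (+-identityˡ _))

    ∑-map : {B : Set} (F : B → Carrier) (g : A → B) → ∀ xs → ∑ F (map g xs) ≡ ∑ (F ∘ g) xs
    ∑-map F g xs = ≡.cong (foldr _+_ 0#) (≡.sym (map-∘ xs))

  ∑-concatMap : {A B : Set} (F : B → Carrier) (g : A → List B) → ∀ xs →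
                ∑ F (concatMap g xs) ≈ ∑ (λ x → ∑ F (g x)) xs
  ∑-concatMap F g []       = refl
  ∑-concatMap F g (x ∷ xs) =
    trans (∑-++ F (g x) (concatMap g xs)) (+-congˡ (∑-concatMap F g xs))

  ∑-upTo : ∀ F n → ∑ F (upTo n) ≈ below F n
  ∑-upTo F zero    = refl
  ∑-upTo F (suc n) = begin
    ∑ F (upTo (suc n))        ≡⟨ ≡.cong (∑ F) (upTo-∷ʳ n) ⟨
    ∑ F (upTo n ∷ʳ n)         ≈⟨ ∑-++ F (upTo n) (n ∷ []) ⟩
    ∑ F (upTo n) + (F n + 0#) ≈⟨ +-cong (∑-upTo F n) (+-identityʳ (F n)) ⟩
    below F n + F n           ∎

  -- The system of the locked generating functions, with `z` and `u` in the role of x and `v` in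
  -- that of x y. The constant term `c` stays open because shifting and stacking both change it.
  Solution : (c z u v : Carrier) (G : ℕ → Carrier) → Set ℓ
  Solution c z u v G = ∀ a → G a ≈ c + z * (G a + u * G (suc a) + v * below G a)

  -- The sum over the letters below `suc a` contains `G 0`, which the shifted sequence no longer
  -- has; this summand moves into the constant term.
  solution-suc : ∀ {z u v G} → Solution 1# z u v G →
                 Solution (1# + z * v * G 0) z u v (G ∘ suc)
  solution-suc {z} {u} {v} {G} sol a = begin
    G (suc a)
      ≈⟨ sol (suc a) ⟩
    1# + z * (G (suc a) + u * G (suc (suc a)) + v * below G (suc a))
      ≈⟨ +-congˡ (*-congˡ (+-congˡ (*-congˡ (below-suc G a)))) ⟩
    1# + z * (G (suc a) + u * G (suc (suc a)) + v * (G 0 + below (G ∘ suc) a))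
      ≈⟨ solve 7 (λ z u v g₀ g₁ g₂ s →
           con 1 :+ z :* (g₁ :+ u :* g₂ :+ v :* (g₀ :+ s)) :=
           con 1 :+ z :* v :* g₀ :+ z :* (g₁ :+ u :* g₂ :+ v :* s))
         refl z u v (G 0) (G (suc a)) (G (suc (suc a))) (below (G ∘ suc) a) ⟩
    1# + z * v * G 0 + z * (G (suc a) + u * G (suc (suc a)) + v * below (G ∘ suc) a) ∎

  -- The system is linear, so scaling a solution by `1# + z * v * G 0` scales its constant term by
  -- the same factor.
  solution-stacked : ∀ {z u v G} → Solution 1# z u v G →
                     Solution (1# + z * v * G 0) z u v (λ a → G a + z * v * G 0 * G a)
  solution-stacked {z} {u} {v} {G} sol a = begin
    G a + t * G a
      ≈⟨ solve 2 (λ t g → g :+ t :* g := (con 1 :+ t) :* g) refl t (G a) ⟩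
    (1# + t) * G a
      ≈⟨ *-congˡ (sol a) ⟩
    (1# + t) * (1# + z * (G a + u * G (suc a) + v * below G a))
      ≈⟨ solve 7 (λ t z u v g g₁ s →
           (con 1 :+ t) :* (con 1 :+ z :* (g :+ u :* g₁ :+ v :* s)) :=
           con 1 :+ t :+ z :* (g :+ t :* g :+ u :* (g₁ :+ t :* g₁) :+ v :* (s :+ t :* s)))
         refl t z u v (G a) (G (suc a)) (below G a) ⟩
    1# + t + z * (H a + u * H (suc a) + v * (below G a + t * below G a))
      ≈⟨ +-congˡ (*-congˡ (+-congˡ (*-congˡ below-H))) ⟨
    1# + t + z * (H a + u * H (suc a) + v * below H a) ∎
    where
    t = z * v * G 0
    H = λ a → G a + t * G a

    below-H : below H a ≈ below G a + t * below G a
    below-H = trans (below-+ G (λ b → t * G b) a) (+-congˡ (sym (*-distribˡ-below t G a)))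

  x-y≈z⇒y≈x-z : ∀ x y z → x - y ≈ z → y ≈ x - z
  x-y≈z⇒y≈x-z x y z x-y≈z = ∙-cancelʳ z _ _ (begin
    y + z          ≈⟨ +-congˡ x-y≈z ⟨
    y + (x - y)    ≈⟨ solve 3 (λ x y m → y :+ (x :+ m) := x :+ (y :+ m)) refl x y (- y) ⟩
    x + (y - y)    ≈⟨ +-congˡ (trans (-‿inverseʳ y) (sym (-‿inverseˡ z))) ⟩
    x + (- z + z)  ≈⟨ +-assoc x (- z) z ⟨
    x - z + z      ∎)

  difference-of-squares : ∀ s t → s * s ≈ t * t → (s - t) * (s + t) ≈ 0#
  difference-of-squares s t ss≈tt = begin
    (s - t) * (s + t)                  ≈⟨ solve 3 (λ s t m → (s :+ m) :* (s :+ t) :=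
                                            s :* s :+ m :* t :+ s :* (t :+ m)) refl s t (- t) ⟩
    s * s + - t * t + s * (t - t)      ≈⟨ +-cong (+-cong ss≈tt (sym (-‿distribˡ-* t t)))
                                                 (trans (*-congˡ (-‿inverseʳ t)) (zeroʳ s)) ⟩
    t * t - t * t + 0#                 ≈⟨ +-identityʳ _ ⟩
    t * t - t * t                      ≈⟨ -‿inverseʳ _ ⟩
    0#                                 ∎

  -- The element `d` will be the constant term of a sum of two square roots, which equals 2 only up
  -- to `_≈_`.
  torsion-free⇒double-regular : (∀ r → r + r ≈ 0# → r ≈ 0#) →
    ∀ {d} → d ≈ 1# + 1# → ∀ r → r * d ≈ 0# → r ≈ 0#
  torsion-free⇒double-regular torsion-free {d} d≈2 r rd≈0 = torsion-free r (begin
    r + r          ≈⟨ solve 1 (λ r → r :+ r := r :* con 2) refl r ⟩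
    r * (1# + 1#)  ≈⟨ *-congˡ d≈2 ⟨
    r * d          ≈⟨ rd≈0 ⟩
    0#             ∎)

  -- Completing the square: s is q - 2pr, and q² = s² + 4pr(s + pr), while the quadratic for r says
  -- exactly that r(s + pr) = 1. The hypothesis on s is additive, so that the semiring solver
  -- suffices.
  discriminant-square : ∀ p q r s → s + (1# + 1#) * p * r ≈ q → q * r ≈ 1# + p * (r * r) →
    s * s + (1# + 1# + 1# + 1#) * p ≈ q * q
  discriminant-square p q r s s+2pr≈q qr≈1+prr = begin
    s * s + four * p                       ≈⟨ +-congˡ (*-congˡ (*-identityʳ p)) ⟨
    s * s + four * (p * 1#)                ≈⟨ +-congˡ (*-congˡ (*-congˡ r*[s+pr]≈1)) ⟨
    s * s + four * (p * (r * (s + p * r))) ≈⟨ solve 3 (λ p r s →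
        s :* s :+ con 4 :* (p :* (r :* (s :+ p :* r))) :=
        (s :+ con 2 :* p :* r) :* (s :+ con 2 :* p :* r)) refl p r s ⟩
    (s + two * p * r) * (s + two * p * r)  ≈⟨ *-cong s+2pr≈q s+2pr≈q ⟩
    q * q                                  ∎
    where
    two  = 1# + 1#
    four = 1# + 1# + 1# + 1#
    r*[s+pr]≈1 : r * (s + p * r) ≈ 1#
    r*[s+pr]≈1 = ∙-cancelʳ (p * (r * r)) _ _ (begin
      r * (s + p * r) + p * (r * r) ≈⟨ solve 3 (λ p r s →
        r :* (s :+ p :* r) :+ p :* (r :* r) := (s :+ con 2 :* p :* r) :* r) refl p r s ⟩
      (s + two * p * r) * r         ≈⟨ *-congʳ s+2pr≈q ⟩
      q * r                         ≈⟨ qr≈1+prr ⟩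
      1# + p * (r * r)              ∎)

  -- After adding (z + z²)r to both sides, the left becomes r itself and the right is the expanded
  -- fixed-point equation.
  quadratic-equation : ∀ q z w r → q + (z + z * z) ≈ 1# →
    r ≈ 1# + z * (r + z * (r + z * (z * w) * r * r)) →
    q * r ≈ 1# + z * (z * (z * (z * 1#))) * w * (r * r)
  quadratic-equation q z w r q+z+zz≈1 r≈ = ∙-cancelʳ ((z + z * z) * r) _ _ (begin
    q * r + (z + z * z) * r
      ≈⟨ distribʳ r q (z + z * z) ⟨
    (q + (z + z * z)) * r
      ≈⟨ *-congʳ q+z+zz≈1 ⟩
    1# * r
      ≈⟨ *-identityˡ r ⟩
    r
      ≈⟨ r≈ ⟩
    1# + z * (r + z * (r + z * (z * w) * r * r))
      ≈⟨ solve 3 (λ z w r →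
           con 1 :+ z :* (r :+ z :* (r :+ z :* (z :* w) :* r :* r)) :=
           con 1 :+ z :* (z :* (z :* (z :* con 1))) :* w :* (r :* r) :+ (z :+ z :* z) :* r)
         refl z w r ⟩
    1# + z * (z * (z * (z * 1#))) * w * (r * r) + (z + z * z) * r ∎)

  -- The sums and powers are spelled out as Defs unfolds them, with o, t and f for nat 1, nat 2
  -- and nat 4.
  quadratic-root-square : ∀ {o t f} z w r → o ≈ 1# → t ≈ 1# + 1# → f ≈ 1# + 1# + 1# + 1# →
    r ≈ 1# + z * (r + z * (r + z * (z * w) * r * r)) →
    let z⁴ = z * (z * (z * (z * o))) ; q = o - z - z * (z * o) ; s = q - t * z⁴ * w * r in
    s * s ≈ q * (q * o) - f * z⁴ * w
  quadratic-root-square {o} {t} {f} z w r o≈1 t≈2 f≈4 r≈ = begin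
    s * s
      ≈⟨ -‿cancelʳ (s * s) (f * z⁴ * w) ⟨
    s * s + f * z⁴ * w - f * z⁴ * w
      ≈⟨ +-congʳ (+-congˡ (trans (*-assoc _ _ _) (*-cong f≈4 p≈p₁))) ⟩
    s * s + (1# + 1# + 1# + 1#) * p₁ - f * z⁴ * w
      ≈⟨ +-congʳ (discriminant-square p₁ q r s s+2pr≈q
           (quadratic-equation q z w r q+z+zz≈1 r≈)) ⟩
    q * q - f * z⁴ * w
      ≈⟨ +-congʳ (*-congˡ (trans (*-congˡ o≈1) (*-identityʳ q))) ⟨
    q * (q * o) - f * z⁴ * w ∎
    where
    z⁴ = z * (z * (z * (z * o)))
    q  = o - z - z * (z * o)
    s  = q - t * z⁴ * w * r
    p₁ = z * (z * (z * (z * 1#))) * w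

    -‿cancelʳ : ∀ a b → a + b - b ≈ a
    -‿cancelʳ a b = trans (+-assoc a b (- b)) (trans (+-congˡ (-‿inverseʳ b)) (+-identityʳ a))

    +‿cancelʳ : ∀ a b → a - b + b ≈ a
    +‿cancelʳ a b = trans (+-assoc a (- b) b) (trans (+-congˡ (-‿inverseˡ b)) (+-identityʳ a))

    p≈p₁ : z⁴ * w ≈ p₁
    p≈p₁ = *-congʳ (*-congˡ (*-congˡ (*-congˡ (*-congˡ o≈1))))

    s+2pr≈q : s + (1# + 1#) * p₁ * r ≈ q
    s+2pr≈q = begin
      s + (1# + 1#) * p₁ * r ≈⟨ +-congˡ (*-congʳ (*-cong t≈2 p≈p₁)) ⟨
      s + t * (z⁴ * w) * r   ≈⟨ +-congˡ (*-congʳ (*-assoc t z⁴ w)) ⟨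
      s + t * z⁴ * w * r     ≈⟨ +‿cancelʳ q _ ⟩
      q                      ∎

    q+z+zz≈1 : q + (z + z * z) ≈ 1#
    q+z+zz≈1 = begin
      q + (z + z * z)               ≈⟨ +-congˡ (+-congˡ (*-congˡ z*o≈z)) ⟨
      q + (z + z * (z * o))         ≈⟨ solve 3 (λ a b c → a :+ (b :+ c) := a :+ c :+ b)
                                         refl q z (z * (z * o)) ⟩
      q + z * (z * o) + z           ≈⟨ +-congʳ (+‿cancelʳ (o - z) _) ⟩
      o - z + z                     ≈⟨ +‿cancelʳ o z ⟩
      o                             ≈⟨ o≈1 ⟩
      1#                            ∎
      where
      z*o≈z = trans (*-congˡ o≈1) (*-identityʳ z)

-- Formal power series over a commutative ring.

module PowerSeries {c ℓ} (R : CommutativeRing c ℓ) where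
  open CommutativeRing R
  open SetoidReasoning setoid

  infixl 7 _⊛_
  infix  4 _≋_

  -- The Cauchy product, in the same form as the product of series in x, so that the two agree
  -- definitionally. It unfolds at `suc n` to `f 0 * g (suc n) + (f ∘ suc ⊛ g) n`, which drives the
  -- inductions below.
  _⊛_ : (f g : ℕ → Carrier) → ℕ → Carrier
  (f ⊛ g) n = foldr _+_ 0# (applyUpTo (λ i → f i * g (n ∸ i)) (suc n))

  _≋_ : (f g : ℕ → Carrier) → Set ℓ
  f ≋ g = ∀ n → f n ≈ g n

  one : ℕ → Carrier
  one zero    = 1#
  one (suc _) = 0#

  private
    variable
      f f′ g g′ : ℕ → Carrier

  -- Coefficient `n` of a product only sees coefficients up to `n` of the factors; this locality is
  -- what the uniqueness argument for the system needs.
  ⊛-cong-≤ : ∀ n → (∀ i → i ≤ n → f i ≈ f′ i) → (∀ i → i ≤ n → g i ≈ g′ i) →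
             (f ⊛ g) n ≈ (f′ ⊛ g′) n
  ⊛-cong-≤ zero    f≈f′ g≈g′ = +-congʳ (*-cong (f≈f′ 0 z≤n) (g≈g′ 0 z≤n))
  ⊛-cong-≤ (suc n) f≈f′ g≈g′ =
    +-cong (*-cong (f≈f′ 0 z≤n) (g≈g′ (suc n) ℕₚ.≤-refl))
           (⊛-cong-≤ n (λ i i≤n → f≈f′ (suc i) (s≤s i≤n))
                       (λ i i≤n → g≈g′ i (ℕₚ.m≤n⇒m≤1+n i≤n)))

  ⊛-cong : f ≋ f′ → g ≋ g′ → f ⊛ g ≋ f′ ⊛ g′
  ⊛-cong f≋f′ g≋g′ n = ⊛-cong-≤ n (λ i _ → f≋f′ i) (λ i _ → g≋g′ i)

  ⊛-zeroˡ : f ≋ (λ _ → 0#) → ∀ g → f ⊛ g ≋ (λ _ → 0#)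
  ⊛-zeroˡ {f} f≋0 g zero = begin
    f 0 * g 0 + 0# ≈⟨ +-identityʳ _ ⟩
    f 0 * g 0      ≈⟨ *-congʳ (f≋0 0) ⟩
    0# * g 0       ≈⟨ zeroˡ _ ⟩
    0#             ∎
  ⊛-zeroˡ {f} f≋0 g (suc n) = begin
    f 0 * g (suc n) + (f ∘ suc ⊛ g) n ≈⟨ +-cong (*-congʳ (f≋0 0)) (⊛-zeroˡ (f≋0 ∘ suc) g n) ⟩
    0# * g (suc n) + 0#               ≈⟨ +-identityʳ _ ⟩
    0# * g (suc n)                    ≈⟨ zeroˡ _ ⟩
    0#                                ∎

  ⊛-identityˡ : ∀ f → one ⊛ f ≋ f
  ⊛-identityˡ f zero    = trans (+-identityʳ _) (*-identityˡ _)
  ⊛-identityˡ f (suc n) =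
    trans (+-cong (*-identityˡ _) (⊛-zeroˡ (λ _ → refl) f n)) (+-identityʳ _)

  ⊛-distribʳ : ∀ h f g → (λ n → f n + g n) ⊛ h ≋ (λ n → (f ⊛ h) n + (g ⊛ h) n)
  ⊛-distribʳ h f g zero = begin
    (f 0 + g 0) * h 0 + 0#                ≈⟨ +-identityʳ _ ⟩
    (f 0 + g 0) * h 0                     ≈⟨ distribʳ _ _ _ ⟩
    f 0 * h 0 + g 0 * h 0                 ≈⟨ +-cong (+-identityʳ _) (+-identityʳ _) ⟨
    (f 0 * h 0 + 0#) + (g 0 * h 0 + 0#)   ∎
  ⊛-distribʳ h f g (suc n) = begin
    (f 0 + g 0) * h (suc n) + ((λ n → f (suc n) + g (suc n)) ⊛ h) n
      ≈⟨ +-cong (distribʳ _ _ _) (⊛-distribʳ h (f ∘ suc) (g ∘ suc) n) ⟩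
    (f 0 * h (suc n) + g 0 * h (suc n)) + ((f ∘ suc ⊛ h) n + (g ∘ suc ⊛ h) n)
      ≈⟨ interchange _ _ _ _ ⟩
    (f 0 * h (suc n) + (f ∘ suc ⊛ h) n) + (g 0 * h (suc n) + (g ∘ suc ⊛ h) n) ∎
    where open CommutativeSemigroupProperties +-commutativeSemigroup using (interchange)

  ⊛-scaleˡ : ∀ r f g → (λ n → r * f n) ⊛ g ≋ (λ n → r * (f ⊛ g) n)
  ⊛-scaleˡ r f g zero = begin
    r * f 0 * g 0 + 0#    ≈⟨ +-identityʳ _ ⟩
    r * f 0 * g 0         ≈⟨ *-assoc _ _ _ ⟩
    r * (f 0 * g 0)       ≈⟨ *-congˡ (+-identityʳ _) ⟨
    r * (f 0 * g 0 + 0#)  ∎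
  ⊛-scaleˡ r f g (suc n) = begin
    r * f 0 * g (suc n) + ((λ n → r * f (suc n)) ⊛ g) n
      ≈⟨ +-cong (*-assoc _ _ _) (⊛-scaleˡ r (f ∘ suc) g n) ⟩
    r * (f 0 * g (suc n)) + r * (f ∘ suc ⊛ g) n
      ≈⟨ distribˡ _ _ _ ⟨
    r * (f 0 * g (suc n) + (f ∘ suc ⊛ g) n) ∎

  -- The shift of `f ⊛ g` is `f 0` times the shift of `g` plus `f ∘ suc ⊛ g`. Distributivity and
  -- scaling separate the two, and induction handles the second.
  ⊛-assoc : ∀ f g h → (f ⊛ g) ⊛ h ≋ f ⊛ (g ⊛ h)
  ⊛-assoc f g h zero = +-congʳ (begin
    (f 0 * g 0 + 0#) * h 0 ≈⟨ *-congʳ (+-identityʳ _) ⟩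
    f 0 * g 0 * h 0        ≈⟨ *-assoc _ _ _ ⟩
    f 0 * (g 0 * h 0)      ≈⟨ *-congˡ (+-identityʳ _) ⟨
    f 0 * (g 0 * h 0 + 0#) ∎)
  ⊛-assoc f g h (suc n) = begin
    (f 0 * g 0 + 0#) * h (suc n) + ((λ m → f 0 * g (suc m) + (f ∘ suc ⊛ g) m) ⊛ h) n
      ≈⟨ +-cong (trans (*-congʳ (+-identityʳ _)) (*-assoc _ _ _))
                (⊛-distribʳ h (λ m → f 0 * g (suc m)) (f ∘ suc ⊛ g) n) ⟩
    f 0 * (g 0 * h (suc n)) + (((λ m → f 0 * g (suc m)) ⊛ h) n + ((f ∘ suc ⊛ g) ⊛ h) n)
      ≈⟨ +-congˡ (+-cong (⊛-scaleˡ (f 0) (g ∘ suc) h n) (⊛-assoc (f ∘ suc) g h n)) ⟩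
    f 0 * (g 0 * h (suc n)) + (f 0 * (g ∘ suc ⊛ h) n + (f ∘ suc ⊛ (g ⊛ h)) n)
      ≈⟨ +-assoc _ _ _ ⟨
    (f 0 * (g 0 * h (suc n)) + f 0 * (g ∘ suc ⊛ h) n) + (f ∘ suc ⊛ (g ⊛ h)) n
      ≈⟨ +-congʳ (distribˡ _ _ _) ⟨
    f 0 * (g 0 * h (suc n) + (g ∘ suc ⊛ h) n) + (f ∘ suc ⊛ (g ⊛ h)) n ∎

  -- Splits off the last summand where the definition splits off the first; commutativity follows by
  -- matching the two.
  ⊛-sucʳ : ∀ f g n → (f ⊛ g) (suc n) ≈ (f ⊛ g ∘ suc) n + f (suc n) * g 0
  ⊛-sucʳ f g zero    = +-cong (sym (+-identityʳ _)) (+-identityʳ _)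
  ⊛-sucʳ f g (suc n) =
    trans (+-congˡ (⊛-sucʳ (f ∘ suc) g n)) (sym (+-assoc _ _ _))

  ⊛-comm : ∀ f g → f ⊛ g ≋ g ⊛ f
  ⊛-comm f g zero    = +-congʳ (*-comm _ _)
  ⊛-comm f g (suc n) = begin
    f 0 * g (suc n) + (f ∘ suc ⊛ g) n ≈⟨ +-cong (*-comm _ _) (⊛-comm (f ∘ suc) g n) ⟩
    g (suc n) * f 0 + (g ⊛ f ∘ suc) n ≈⟨ +-comm _ _ ⟩
    (g ⊛ f ∘ suc) n + g (suc n) * f 0 ≈⟨ ⊛-sucʳ g f n ⟨
    (g ⊛ f) (suc n)                   ∎

  ⊛-isCommutativeRing : IsCommutativeRing _≋_ (λ f g n → f n + g n) _⊛_
                        (λ f n → - f n) (λ _ → 0#) one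
  ⊛-isCommutativeRing = record
    { isRing = record
      { +-isAbelianGroup = +-isAbelianGroup′
      ; *-cong     = ⊛-cong
      ; *-assoc    = ⊛-assoc
      ; *-identity = comm∧idˡ⇒id ⊛-comm ⊛-identityˡ
      ; distrib    = comm∧distrʳ⇒distr +-cong′ ⊛-comm ⊛-distribʳ
      }
    ; *-comm = ⊛-comm
    }
    where
    +-isAbelianGroup′ = Pointwise.isAbelianGroup ℕ +-isAbelianGroup
    +-cong′ = IsAbelianGroup.∙-cong +-isAbelianGroup′
    ≋-setoid : Setoid c ℓ
    ≋-setoid = record { isEquivalence = IsAbelianGroup.isEquivalence +-isAbelianGroup′ }
    open Consequences ≋-setoid using (comm∧idˡ⇒id; comm∧distrʳ⇒distr)

  seriesRing : CommutativeRing c ℓ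
  seriesRing = record { isCommutativeRing = ⊛-isCommutativeRing }

  -- Uniqueness of solutions and of square roots.

  ⊛-suc : ∀ f g n → f 0 ≈ 0# → (f ⊛ g) (suc n) ≈ (f ∘ suc ⊛ g) n
  ⊛-suc f g n f0≈0 = trans (+-congʳ (trans (*-congʳ f0≈0) (zeroˡ _))) (+-identityˡ _)

  -- The lowest coefficient of the product forces `f 0` to vanish. Then the shift of `f` also has
  -- zero product with `g`, and the argument repeats.
  regular-constant-term : ∀ {g} → (∀ r → r * g 0 ≈ 0# → r ≈ 0#) →
                          ∀ f → f ⊛ g ≋ (λ _ → 0#) → f ≋ (λ _ → 0#)
  regular-constant-term {g} regular f fg≋0 = go
    where
    f0≈0 : f 0 ≈ 0#
    f0≈0 = regular (f 0) (trans (sym (+-identityʳ _)) (fg≋0 0))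

    go : f ≋ (λ _ → 0#)
    go zero    = f0≈0
    go (suc n) = regular-constant-term regular (f ∘ suc)
      (λ m → trans (sym (⊛-suc f g m f0≈0)) (fg≋0 (suc m))) n

  private
    module S = CommutativeRing seriesRing
    open RingIdentities seriesRing using (below; Solution; solution-suc; solution-stacked)
    open RingIdentities R using () renaming (below-cong to below-congᴿ; below to belowᴿ)

  below-coeff : ∀ F a n → below F a n ≡ belowᴿ (λ b → F b n) a
  below-coeff F zero    n = ≡.refl
  below-coeff F (suc a) n = ≡.cong (_+ F a n) (below-coeff F a n)

  -- The right-hand side of Solution is contracting: its coefficients up to n involve those of G up to n - 1.
  solution-unique : ∀ {c z u v G H} → z 0 ≈ 0# →
                    Solution c z u v G → Solution c z u v H → ∀ a → G a ≋ H a
  solution-unique {c} {z} {u} {v} {G} {H} z0≈0 solG solH a n = go (suc n) a n ℕₚ.≤-refl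
    where
    rhs : (ℕ → ℕ → Carrier) → ℕ → ℕ → Carrier
    rhs G a = G a S.+ u ⊛ G (suc a) S.+ v ⊛ below G a

    z⊛-cong-< : ∀ f g n → (∀ i → i < n → f i ≈ g i) → (z ⊛ f) n ≈ (z ⊛ g) n
    z⊛-cong-< f g zero    f≈g = +-congʳ (begin
      z 0 * f 0 ≈⟨ *-congʳ z0≈0 ⟩
      0# * f 0  ≈⟨ zeroˡ _ ⟩
      0#        ≈⟨ zeroˡ _ ⟨
      0# * g 0  ≈⟨ *-congʳ z0≈0 ⟨
      z 0 * g 0 ∎)
    z⊛-cong-< f g (suc n) f≈g = begin
      (z ⊛ f) (suc n)   ≈⟨ ⊛-suc z f n z0≈0 ⟩
      (z ∘ suc ⊛ f) n   ≈⟨ ⊛-cong-≤ {z ∘ suc} n (λ _ _ → refl) (λ i i≤n → f≈g i (s≤s i≤n)) ⟩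
      (z ∘ suc ⊛ g) n   ≈⟨ ⊛-suc z g n z0≈0 ⟨
      (z ⊛ g) (suc n)   ∎

    go : ∀ n a i → i < n → G a i ≈ H a i
    go (suc n) a i (s≤s i≤n) = begin
      G a i                  ≈⟨ solG a i ⟩
      c i + (z ⊛ rhs G a) i  ≈⟨ +-congˡ (z⊛-cong-< (rhs G a) (rhs H a) i λ j j<i →
                                  rhs-cong j (ℕₚ.<-≤-trans j<i i≤n)) ⟩
      c i + (z ⊛ rhs H a) i  ≈⟨ solH a i ⟨
      H a i                  ∎
      where
      rhs-cong : ∀ j → j < n → rhs G a j ≈ rhs H a j
      rhs-cong j j<n = +-cong (+-cong (go n a j j<n)
        (⊛-cong-≤ {u} j (λ _ _ → refl) λ k k≤j → go n (suc a) k (ℕₚ.≤-<-trans k≤j j<n)))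
        (⊛-cong-≤ {v} j (λ _ _ → refl) λ k k≤j → begin
          below G a k               ≡⟨ below-coeff G a k ⟩
          belowᴿ (λ b → G b k) a    ≈⟨ below-congᴿ a (λ b _ → go n b k (ℕₚ.≤-<-trans k≤j j<n)) ⟩
          belowᴿ (λ b → H b k) a    ≡⟨ below-coeff H a k ⟨
          below H a k               ∎)

  -- The shifted and the stacked sequence solve one and the same system, so they coincide.
  solution-increment : ∀ {z u v G} → z 0 ≈ 0# → Solution one z u v G →
                       ∀ a → G (suc a) ≋ G a S.+ z ⊛ v ⊛ G 0 ⊛ G a
  solution-increment {z} {u} {v} {G} z0≈0 sol = solution-unique
    {one S.+ z ⊛ v ⊛ G 0} {z} {u} {v} z0≈0
    (solution-suc {z} {u} {v} {G} sol) (solution-stacked {z} {u} {v} {G} sol)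

  -- The product of s - t and s + t vanishes, and s + t has constant term 2, which is regular in the
  -- absence of 2-torsion.
  sqrt-unique : (∀ r → r + r ≈ 0# → r ≈ 0#) →
                ∀ s t → s 0 ≈ 1# → t 0 ≈ 1# → s ⊛ s ≋ t ⊛ t → s ≋ t
  sqrt-unique torsion-free s t s0≈1 t0≈1 ss≋tt n = x∙y⁻¹≈ε⇒x≈y (s n) (t n)
    (regular-constant-term {s S.+ t}
      (torsion-free⇒double-regular torsion-free (+-cong s0≈1 t0≈1))
      (s S.- t) (RingIdentities.difference-of-squares seriesRing s t ss≋tt) n)
    where
    open RingIdentities R using (torsion-free⇒double-regular)
    open GroupProperties +-group using (x∙y⁻¹≈ε⇒x≈y)

-- Words avoiding two consecutive changes.

Avoids? : Decidable (Avoids _≢_ _≢_)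
Avoids? = avoids? _≢?_ _≢?_

avoids-stutter : ∀ a w → Avoids _≢_ _≢_ (a ∷ a ∷ w) ⇔ Avoids _≢_ _≢_ (a ∷ w)
avoids-stutter a w = mk⇔ (λ av → av ∘ there)
  (λ { av (here a≢a _) → a≢a ≡.refl ; av (there c) → av c })

-- Both triples that start at the first two letters involve the repetition of `b`, so neither can be
-- an occurrence.
avoids-change : ∀ a b w → Avoids _≢_ _≢_ (a ∷ b ∷ b ∷ w) ⇔ Avoids _≢_ _≢_ (b ∷ w)
avoids-change a b w = mk⇔ (λ av → av ∘ there ∘ there)
  (λ { av (here _ b≢b) → b≢b ≡.refl ; av (there (here b≢b _)) → b≢b ≡.refl
     ; av (there (there c)) → av c })

<ᵇ-irrefl : ∀ a → (a <ᵇ a) ≡ false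
<ᵇ-irrefl zero    = ≡.refl
<ᵇ-irrefl (suc a) = <ᵇ-irrefl a

des-stutter : ∀ a w → des (a ∷ a ∷ w) ≡ des (a ∷ w)
des-stutter a w rewrite <ᵇ-irrefl a = ≡.refl

-- `Y` and `pow` stand for y and its powers. The count needs only the two laws of `pow` and is later
-- instantiated with polynomials.
module WeightedWords {c ℓ} (R : CommutativeRing c ℓ)
  (Y : CommutativeRing.Carrier R) (pow : ℕ → CommutativeRing.Carrier R)
  (pow-0 : CommutativeRing._≈_ R (pow 0) (CommutativeRing.1# R))
  (pow-suc : ∀ k → CommutativeRing._≈_ R (pow (suc k)) (CommutativeRing._*_ R Y (pow k))) where
  open CommutativeRing R
  open RingIdentities R
  open SetoidReasoning setoid

  -- Splits by the next letter. The bound `suc (suc a)` makes the right side unfold to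
  -- `below F a + F a + F (suc a)` for the summand `F` in question: descents, the repetition and the
  -- ascent.
  ∑-continuations : ∀ F a n → ∑ F (continuations a (suc n)) ≈
                    below (λ b → ∑ (F ∘ (b ∷_)) (continuations b n)) (suc (suc a))
  ∑-continuations F a n = begin
    ∑ F (continuations a (suc n))
      ≈⟨ ∑-concatMap F (λ b → map (b ∷_) (continuations b n)) (upTo (suc (suc a))) ⟩
    ∑ (λ b → ∑ F (map (b ∷_) (continuations b n))) (upTo (suc (suc a)))
      ≈⟨ ∑-cong (λ b → reflexive (∑-map F (b ∷_) (continuations b n))) (upTo (suc (suc a))) ⟩
    ∑ (λ b → ∑ (F ∘ (b ∷_)) (continuations b n)) (upTo (suc (suc a)))
      ≈⟨ ∑-upTo _ (suc (suc a)) ⟩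
    below (λ b → ∑ (F ∘ (b ∷_)) (continuations b n)) (suc (suc a)) ∎

  weight : Word → Carrier
  weight w = if does (Avoids? w) then pow (des w) else 0#

  -- The weight of a ∷ w when a is reached by a step ≠ whose own weight is left out.
  locked : ℕ → Word → Carrier
  locked a []      = 1#
  locked a (b ∷ w) = if does (b ℕₚ.≟ a) then weight (a ∷ w) else 0#

  locked-same : ∀ a w → locked a (a ∷ w) ≡ weight (a ∷ w)
  locked-same a w =
    ≡.cong (λ v → if v then weight (a ∷ w) else 0#) (dec-true (a ℕₚ.≟ a) ≡.refl)

  locked-other : ∀ {a b} → b ≢ a → ∀ w → locked a (b ∷ w) ≡ 0#
  locked-other {a} {b} b≢a w =
    ≡.cong (λ v → if v then weight (a ∷ w) else 0#) (dec-false (b ℕₚ.≟ a) b≢a)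

  weight-stutter : ∀ a w → weight (a ∷ a ∷ w) ≡ weight (a ∷ w)
  weight-stutter a w = ≡.cong₂ (λ c d → if c then pow d else 0#)
    (does-⇔ (avoids-stutter a w) (Avoids? _) (Avoids? _)) (des-stutter a w)

  stepWeight : ℕ → ℕ → Carrier
  stepWeight a b = if b <ᵇ a then Y else 1#

  pow-des : ∀ a b w → pow (des (a ∷ b ∷ w)) ≈ stepWeight a b * pow (des (b ∷ w))
  pow-des a b w with b <ᵇ a
  ... | true  = pow-suc (des (b ∷ w))
  ... | false = sym (*-identityˡ _)

  -- After the change from `a` to `b`, a further letter other than `b` would complete an occurrence,
  -- so only locked continuations of `b` survive.
  weight-change : ∀ {a b} → a ≢ b → ∀ w → weight (a ∷ b ∷ w) ≈ stepWeight a b * locked b w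
  weight-change {a} {b} a≢b [] = trans (pow-des a b []) (*-congˡ pow-0)
  weight-change {a} {b} a≢b (c ∷ w) with c ℕₚ.≟ b
  ... | no c≢b = begin
    weight (a ∷ b ∷ c ∷ w)
      ≡⟨ ≡.cong (λ v → if v then pow (des (a ∷ b ∷ c ∷ w)) else 0#)
           (dec-false (Avoids? (a ∷ b ∷ c ∷ w)) λ av → av (here a≢b (c≢b ∘ ≡.sym))) ⟩
    0#
      ≈⟨ zeroʳ (stepWeight a b) ⟨
    stepWeight a b * 0#
      ≡⟨ ≡.cong (stepWeight a b *_) (locked-other c≢b w) ⟨
    stepWeight a b * locked b (c ∷ w) ∎
  ... | yes ≡.refl = begin
    weight (a ∷ b ∷ b ∷ w)
      ≡⟨ ≡.cong (λ v → if v then pow (des (a ∷ b ∷ b ∷ w)) else 0#)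
           (does-⇔ (avoids-change a b w) (Avoids? _) (Avoids? (b ∷ w))) ⟩
    (if does (Avoids? (b ∷ w)) then pow (des (a ∷ b ∷ b ∷ w)) else 0#)
      ≈⟨ if-* (does (Avoids? (b ∷ w))) ⟩
    stepWeight a b * weight (b ∷ w)
      ≡⟨ ≡.cong (stepWeight a b *_) (locked-same b w) ⟨
    stepWeight a b * locked b (b ∷ w) ∎
    where
    if-* : ∀ v → (if v then pow (des (a ∷ b ∷ b ∷ w)) else 0#) ≈
                  stepWeight a b * (if v then pow (des (b ∷ w)) else 0#)
    if-* true  = trans (pow-des a b (b ∷ w))
      (reflexive (≡.cong (λ d → stepWeight a b * pow d) (des-stutter b w)))
    if-* false = sym (zeroʳ (stepWeight a b))

  -- Coefficients by length of the continuation: `locked-sum a` is the series L a, and `free-sum a`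
  -- is its counterpart when the next letter is not forced.
  free-sum locked-sum : ℕ → ℕ → Carrier
  free-sum   a n = ∑ (λ w → weight (a ∷ w)) (continuations a n)
  locked-sum a n = ∑ (locked a) (continuations a n)

  -- A nonempty locked continuation must spend its first letter on repeating `a`, after which it is
  -- free.
  locked-sum-suc : ∀ a n → locked-sum a (suc n) ≈ free-sum a n
  locked-sum-suc a n = begin
    locked-sum a (suc n)
      ≈⟨ ∑-continuations (locked a) a n ⟩
    below F a + F a + F (suc a)
      ≈⟨ +-cong (+-cong below≈0 same≈) (off ℕₚ.1+n≢n) ⟩
    0# + free-sum a n + 0#
      ≈⟨ trans (+-identityʳ _) (+-identityˡ _) ⟩
    free-sum a n ∎
    where
    F = λ b → ∑ (λ w → locked a (b ∷ w)) (continuations b n)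

    off : ∀ {b} → b ≢ a → F b ≈ 0#
    off {b} b≢a = ∑-zero (λ w → reflexive (locked-other b≢a w)) (continuations b n)

    same≈ : F a ≈ free-sum a n
    same≈ = ∑-cong (λ w → reflexive (locked-same a w)) (continuations a n)

    below≈0 : below F a ≈ 0#
    below≈0 = below-zero a (λ b b<a → off (ℕₚ.<⇒≢ b<a))

  -- A repetition stays free, the ascent locks `suc a` with weight 1, and each descent locks a
  -- smaller letter with weight `Y`.
  free-sum-suc : ∀ a n → free-sum a (suc n) ≈
    free-sum a n + locked-sum (suc a) n + Y * below (λ b → locked-sum b n) a
  free-sum-suc a n = begin
    free-sum a (suc n)
      ≈⟨ ∑-continuations (λ w → weight (a ∷ w)) a n ⟩
    below F a + F a + F (suc a)
      ≈⟨ +-cong (+-cong below≈ same≈) up≈ ⟩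
    Yb + free-sum a n + locked-sum (suc a) n
      ≈⟨ +-assoc Yb (free-sum a n) (locked-sum (suc a) n) ⟩
    Yb + (free-sum a n + locked-sum (suc a) n)
      ≈⟨ +-comm Yb (free-sum a n + locked-sum (suc a) n) ⟩
    free-sum a n + locked-sum (suc a) n + Yb ∎
    where
    F  = λ b → ∑ (λ w → weight (a ∷ b ∷ w)) (continuations b n)
    Yb = Y * below (λ b → locked-sum b n) a

    same≈ : F a ≈ free-sum a n
    same≈ = ∑-cong (λ w → reflexive (weight-stutter a w)) (continuations a n)

    change : ∀ {b} → a ≢ b → ∀ {r} → stepWeight a b ≡ r → F b ≈ r * locked-sum b n
    change {b} a≢b ≡.refl = trans
      (∑-cong (weight-change a≢b) (continuations b n))
      (sym (*-distribˡ-∑ (stepWeight a b) (locked b) (continuations b n)))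

    up≈ : F (suc a) ≈ locked-sum (suc a) n
    up≈ = trans
      (change (ℕₚ.1+n≢n ∘ ≡.sym) (≡.cong (λ v → if v then Y else 1#) (1+a≮ᵇa a)))
      (*-identityˡ (locked-sum (suc a) n))
      where
      1+a≮ᵇa : ∀ a → (suc a <ᵇ a) ≡ false
      1+a≮ᵇa zero    = ≡.refl
      1+a≮ᵇa (suc a) = 1+a≮ᵇa a

    below≈ : below F a ≈ Yb
    below≈ = trans
      (below-cong a (λ b b<a → change (ℕₚ.<⇒≢ b<a ∘ ≡.sym)
        (≡.cong (λ v → if v then Y else 1#) (Equivalence.to T-≡ (ℕₚ.<⇒<ᵇ b<a)))))
      (sym (*-distribˡ-below Y (λ b → locked-sum b n) a))

  -- The functional equation of the generating function.

  gf : ℕ → Carrier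
  gf n = ∑ (pow ∘ des) (filter Avoids? (catalanWords n))

  -- A nonempty Catalan word is forced to begin with 0 and is free afterwards, just like a locked
  -- continuation of 0.
  gf≈locked-sum : ∀ n → gf n ≈ locked-sum 0 n
  gf≈locked-sum zero    = +-congʳ pow-0
  gf≈locked-sum (suc n) = begin
    gf (suc n)
      ≈⟨ ∑-filter Avoids? (pow ∘ des) (catalanWords (suc n)) ⟩
    ∑ weight (map (0 ∷_) (continuations 0 n))
      ≡⟨ ∑-map weight (0 ∷_) (continuations 0 n) ⟩
    free-sum 0 n
      ≈⟨ locked-sum-suc 0 n ⟨
    locked-sum 0 (suc n) ∎

  open PowerSeries R using (_⊛_; _≋_; one; ⊛-suc; ⊛-zeroˡ; ⊛-cong; ⊛-identityˡ; seriesRing;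
    below-coeff; solution-increment)
  private
    module S = CommutativeRing seriesRing
    module RS = RingIdentities seriesRing

  -- The hypotheses say coefficientwise that `z` is the variable x and `w` the constant series `Y`.
  module _ {z w : ℕ → Carrier} (z-0 : z 0 ≈ 0#) (z-suc : z ∘ suc ≋ one)
           (w-0 : w 0 ≈ Y) (w-suc : w ∘ suc ≋ λ _ → 0#) where

    z⊛-zero : ∀ f → (z ⊛ f) 0 ≈ 0#
    z⊛-zero f = trans (+-identityʳ _) (trans (*-congʳ z-0) (zeroˡ _))

    z⊛-suc : ∀ f n → (z ⊛ f) (suc n) ≈ f n
    z⊛-suc f n = trans (⊛-suc z f n z-0)
      (trans (⊛-cong {g = f} z-suc (λ _ → refl) n) (⊛-identityˡ f n))

    w⊛ : ∀ f n → (w ⊛ f) n ≈ Y * f n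
    w⊛ f zero    = trans (+-identityʳ _) (*-congʳ w-0)
    w⊛ f (suc n) = trans (+-cong (*-congʳ w-0) (⊛-zeroˡ w-suc f n)) (+-identityʳ _)

    zw⊛-suc : ∀ f n → (z ⊛ w ⊛ f) (suc n) ≈ Y * f n
    zw⊛-suc f n = trans (S.*-assoc z w f (suc n)) (trans (z⊛-suc (w ⊛ f) n) (w⊛ f n))

    -- The empty continuation and the repetitions contribute 1 + x `free-sum a`, which is
    -- `locked-sum a`; hence that summand carries no factor x.
    free-sum-equation : ∀ a → free-sum a ≋
      locked-sum a S.+ z ⊛ locked-sum (suc a) S.+ z ⊛ w ⊛ RS.below locked-sum a
    free-sum-equation a zero = begin
      weight (a ∷ []) + 0#  ≈⟨ +-congʳ pow-0 ⟩
      1# + 0#               ≈⟨ +-identityʳ _ ⟨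
      1# + 0# + 0#          ≈⟨ +-identityʳ _ ⟨
      1# + 0# + 0# + 0#     ≈⟨ +-cong (+-congˡ (z⊛-zero (locked-sum (suc a)))) (begin
        (z ⊛ w ⊛ L) 0   ≈⟨ S.*-assoc z w L 0 ⟩
        (z ⊛ (w ⊛ L)) 0 ≈⟨ z⊛-zero (w ⊛ L) ⟩
        0#              ∎) ⟨
      1# + 0# + (z ⊛ locked-sum (suc a)) 0 + (z ⊛ w ⊛ L) 0 ∎
      where L = RS.below locked-sum a
    free-sum-equation a (suc n) = begin
      free-sum a (suc n)
        ≈⟨ free-sum-suc a n ⟩
      free-sum a n + locked-sum (suc a) n + Y * below (λ b → locked-sum b n) a
        ≡⟨ ≡.cong (λ p → free-sum a n + locked-sum (suc a) n + Y * p)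
                  (below-coeff locked-sum a n) ⟨
      free-sum a n + locked-sum (suc a) n + Y * L n
        ≈⟨ +-cong (+-cong (locked-sum-suc a n) (z⊛-suc (locked-sum (suc a)) n)) (zw⊛-suc L n) ⟨
      locked-sum a (suc n) + (z ⊛ locked-sum (suc a)) (suc n) + (z ⊛ w ⊛ L) (suc n) ∎
      where L = RS.below locked-sum a

    locked-sum-solution : RS.Solution one z z (z ⊛ w) locked-sum
    locked-sum-solution a = go
      where
      rhs = locked-sum a S.+ z ⊛ locked-sum (suc a) S.+ z ⊛ w ⊛ RS.below locked-sum a

      go : locked-sum a ≋ one S.+ z ⊛ rhs
      go zero    = +-congˡ (sym (z⊛-zero rhs))
      go (suc n) = begin
        locked-sum a (suc n)       ≈⟨ locked-sum-suc a n ⟩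
        free-sum a n               ≈⟨ free-sum-equation a n ⟩
        rhs n                      ≈⟨ z⊛-suc rhs n ⟨
        (z ⊛ rhs) (suc n)          ≈⟨ +-identityˡ _ ⟨
        0# + (z ⊛ rhs) (suc n)     ∎

    -- The equation of the system at letter 0, where there are no descents, with L 1 eliminated by
    -- the increment formula.
    gf-equation : gf ≋ one S.+ z ⊛ (gf S.+ z ⊛ (gf S.+ z ⊛ (z ⊛ w) ⊛ gf ⊛ gf))
    gf-equation = SR.begin
      gf
        SR.≈⟨ gf≈locked-sum ⟩
      L 0
        SR.≈⟨ locked-sum-solution 0 ⟩
      one S.+ z ⊛ (L 0 S.+ z ⊛ L 1 S.+ z ⊛ w ⊛ S.0#)
        SR.≈⟨ S.+-congˡ {one} (S.*-congˡ {z} (S.trans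
                (S.+-congˡ {L 0 S.+ z ⊛ L 1} (S.zeroʳ (z ⊛ w)))
                (S.+-identityʳ (L 0 S.+ z ⊛ L 1)))) ⟩
      one S.+ z ⊛ (L 0 S.+ z ⊛ L 1)
        SR.≈⟨ S.+-congˡ {one} (S.*-congˡ {z} (S.+-cong L0≋gf (S.*-congˡ {z} L1≋))) ⟩
      one S.+ z ⊛ (gf S.+ z ⊛ (gf S.+ z ⊛ (z ⊛ w) ⊛ gf ⊛ gf)) SR.∎
      where
      module SR = SetoidReasoning S.setoid
      L = locked-sum

      L0≋gf : L 0 ≋ gf
      L0≋gf = S.sym gf≈locked-sum

      L1≋ : L 1 ≋ gf S.+ z ⊛ (z ⊛ w) ⊛ gf ⊛ gf
      L1≋ = S.trans (solution-increment {z} {z} {z ⊛ w} {L} z-0 locked-sum-solution 0)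
        (S.+-cong L0≋gf (S.*-cong (S.*-congˡ {z ⊛ (z ⊛ w)} L0≋gf) L0≋gf))

-- Polynomials in y as a commutative ring.

module ℤ[[y]] = PowerSeries ℤₚ.+-*-commutativeRing
open ℤ[[y]] using (_⊛_)

coeff-+ₚ : ∀ p q k → coeff (p +ₚ q) k ≡ coeff p k ℤ.+ coeff q k
coeff-+ₚ []      q       k       = ≡.sym (ℤₚ.+-identityˡ _)
coeff-+ₚ (a ∷ p) []      k       = ≡.sym (ℤₚ.+-identityʳ _)
coeff-+ₚ (a ∷ p) (b ∷ q) zero    = ≡.refl
coeff-+ₚ (a ∷ p) (b ∷ q) (suc k) = coeff-+ₚ p q k

coeff-map : ∀ (f : ℤ → ℤ) → f 0ℤ ≡ 0ℤ → ∀ p k → coeff (map f p) k ≡ f (coeff p k)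
coeff-map f f0≡0 []      k       = ≡.sym f0≡0
coeff-map f f0≡0 (a ∷ p) zero    = ≡.refl
coeff-map f f0≡0 (a ∷ p) (suc k) = coeff-map f f0≡0 p k

coeff-*ₚ : ∀ p q k → coeff (p *ₚ q) k ≡ (coeff p ⊛ coeff q) k
coeff-*ₚ []      q k = ≡.sym (ℤ[[y]].⊛-zeroˡ (λ _ → ≡.refl) (coeff q) k)
coeff-*ₚ (a ∷ p) q k = ≡.trans (coeff-+ₚ (map (a ℤ.*_) q) (0ℤ ∷ p *ₚ q) k)
  (≡.trans (≡.cong (ℤ._+ _) (coeff-map (a ℤ.*_) (ℤₚ.*-zeroʳ a) q k)) (shifted k))
  where
  shifted : ∀ k → a ℤ.* coeff q k ℤ.+ coeff (0ℤ ∷ p *ₚ q) k ≡ (coeff (a ∷ p) ⊛ coeff q) k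
  shifted zero    = ≡.refl
  shifted (suc k) = ≡.cong (ℤ._+_ (a ℤ.* coeff q (suc k))) (coeff-*ₚ p q k)

coeff-1ₚ : ∀ k → coeff 1ₚ k ≡ ℤ[[y]].one k
coeff-1ₚ zero    = ≡.refl
coeff-1ₚ (suc _) = ≡.refl

polyRawRing : RawRing _ _
polyRawRing = record
  { Carrier = Poly ; _≈_ = _≈ₚ_ ; _+_ = _+ₚ_ ; _*_ = _*ₚ_ ; -_ = -ₚ_ ; 0# = 0ₚ ; 1# = 1ₚ }

-- Equality of polynomials is by definition equality of coefficient sequences, so coefficient lists
-- inherit the ring laws from power series in y.
coeff-isRingMonomorphism :
  IsRingMonomorphism polyRawRing (CommutativeRing.rawRing ℤ[[y]].seriesRing) coeff
coeff-isRingMonomorphism = record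
  { isRingHomomorphism = record
    { isSemiringHomomorphism = record
      { isNearSemiringHomomorphism = record
        { +-isMonoidHomomorphism = record
          { isMagmaHomomorphism = record
            { isRelHomomorphism = record { cong = λ p≈q → p≈q }
            ; homo = coeff-+ₚ
            }
          ; ε-homo = λ _ → ≡.refl
          }
        ; *-homo = coeff-*ₚ
        }
      ; 1#-homo = coeff-1ₚ
      }
    ; -‿homo = coeff-map ℤ.-_ ≡.refl
    }
  ; injective = λ p≈q → p≈q
  }

polyRing : CommutativeRing _ _
polyRing = record
  { isCommutativeRing = RingMonomorphism.isCommutativeRing coeff-isRingMonomorphism
      ℤ[[y]].⊛-isCommutativeRing }

y^-suc : ∀ k → y^ₚ suc k ≈ₚ (y^ₚ 1) *ₚ (y^ₚ k)
y^-suc k i = ≡.sym (≡.trans (coeff-+ₚ (map (0ℤ ℤ.*_) (y^ₚ k)) (0ℤ ∷ 1ₚ *ₚ (y^ₚ k)) i)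
  (≡.trans (≡.cong (ℤ._+ coeff (0ℤ ∷ 1ₚ *ₚ (y^ₚ k)) i) (coeff-map (0ℤ ℤ.*_) ≡.refl (y^ₚ k) i))
  (≡.trans (ℤₚ.+-identityˡ _) (shifted i))))
  where
  shifted : (0ℤ ∷ 1ₚ *ₚ (y^ₚ k)) ≈ₚ y^ₚ suc k
  shifted zero    = ≡.refl
  shifted (suc i) = CommutativeRing.*-identityˡ polyRing (y^ₚ k) i

≈ₚ-torsion-free : ∀ p → p +ₚ p ≈ₚ 0ₚ → p ≈ₚ 0ₚ
≈ₚ-torsion-free p p+p≈0 k = ℤₚ.*-cancelʳ-≡ (coeff p k) 0ℤ (+ 2) (begin
  coeff p k ℤ.* + 2                       ≡⟨ ℤₚ.*-distribˡ-+ (coeff p k) 1ℤ 1ℤ ⟩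
  coeff p k ℤ.* 1ℤ ℤ.+ coeff p k ℤ.* 1ℤ   ≡⟨ ≡.cong (λ c → c ℤ.+ c) (ℤₚ.*-identityʳ (coeff p k)) ⟩
  coeff p k ℤ.+ coeff p k                 ≡⟨ coeff-+ₚ p p k ⟨
  coeff (p +ₚ p) k                        ≡⟨ p+p≈0 k ⟩
  0ℤ ℤ.* + 2                              ∎)
  where open ≡.≡-Reasoning

-- The square root of the discriminant and the closed form.

open import Defs using (Series; _≈_; _+_; _-_; _*_; _^_; nat; x; y; IsSqrt; C)
open import Data.Product using (_×_; ∃!)

private
  module ℤ[y][[x]] = PowerSeries polyRing

-- The ring operations are those of Defs, so that K applies to series without unfolding them.
seriesRing : CommutativeRing _ _
seriesRing = record
  { Carrier = Series ; _≈_ = _≈_ ; _+_ = _+_ ; _*_ = _*_ ; -_ = λ f n → -ₚ f n ; 0# = λ _ → 0ₚ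
  ; 1# = ℤ[y][[x]].one ; isCommutativeRing = ℤ[y][[x]].⊛-isCommutativeRing }

private
  module K = RingIdentities seriesRing
  module W = WeightedWords polyRing (y^ₚ 1) y^ₚ_ (λ _ → ≡.refl) y^-suc

nat-1 : nat 1 ≈ ℤ[y][[x]].one
nat-1 zero    _ = ≡.refl
nat-1 (suc _) _ = ≡.refl

C-equation : let c = C _≢?_ _≢?_ in
  c ≈ ℤ[y][[x]].one + x * (c + x * (c + x * (x * y) * c * c))
C-equation = W.gf-equation {x} {y} (λ _ → ≡.refl) x-suc (λ _ → ≡.refl) (λ _ _ → ≡.refl)
  where
  x-suc : (x ∘ suc) ≈ ℤ[y][[x]].one
  x-suc zero    _ = ≡.refl
  x-suc (suc _) _ = ≡.refl

root-square : ∀ c →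
  c ≈ ℤ[y][[x]].one + x * (c + x * (c + x * (x * y) * c * c)) →
  let q = nat 1 - x - x ^ 2 ; s = q - nat 2 * x ^ 4 * y * c in
  s * s ≈ q ^ 2 - nat 4 * x ^ 4 * y
root-square c = K.quadratic-root-square {nat 1} {nat 2} {nat 4} x y c nat-1
  (λ { zero → λ { zero → ≡.refl ; (suc _) → ≡.refl } ; (suc _) _ → ≡.refl })
  (λ { zero → λ { zero → ≡.refl ; (suc _) → ≡.refl } ; (suc _) _ → ≡.refl })

root-constant-term : (nat 1 - x - x ^ 2 - nat 2 * x ^ 4 * y * C _≢?_ _≢?_) 0 ≈ₚ 1ₚ
-- The constant term evaluates to a list with the entries 1 and a trailing 0, so three cases cover
-- every coefficient.
root-constant-term = λ { 0 → ≡.refl ; 1 → ≡.refl ; (suc (suc _)) → ≡.refl }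

IsSqrt-unique : ∀ f s t → IsSqrt f s → IsSqrt f t → s ≈ t
IsSqrt-unique f s t (ss≈f , s0≈1) (tt≈f , t0≈1) =
  ℤ[y][[x]].sqrt-unique ≈ₚ-torsion-free s t s0≈1 t0≈1
    (λ n k → ≡.trans (ss≈f n k) (≡.sym (tt≈f n k)))

theorem3p45 : let D = (nat 1 - x - x ^ 2) ^ 2 - nat 4 * x ^ 4 * y in
    ∃! _≈_ (IsSqrt D) ×
    ((√D : Series) → IsSqrt D √D →
    nat 2 * x ^ 4 * y * C _≢?_ _≢?_ ≈ nat 1 - x - x ^ 2 - √D)
-- The claimed formula, solved for the root, supplies the witness `S`. Any other root equals `S`,
-- and solving back gives the formula.
theorem3p45 = (S , S-isSqrt , λ {s} → IsSqrt-unique D S s S-isSqrt) ,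
  λ √D √D-isSqrt → K.x-y≈z⇒y≈x-z q (nat 2 * x ^ 4 * y * C _≢?_ _≢?_) √D
    (IsSqrt-unique D S √D S-isSqrt √D-isSqrt)
  where
  q S D : Series
  q = nat 1 - x - x ^ 2
  S = q - nat 2 * x ^ 4 * y * C _≢?_ _≢?_
  D = q ^ 2 - nat 4 * x ^ 4 * y

  S-isSqrt : IsSqrt D S
  S-isSqrt = root-square (C _≢?_ _≢?_) C-equation , root-constant-term
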